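{- For any ${\rm LP}^{\rm MLN}$ program $\mathsf F$ over the signature ${\bf p}=(p_1,\dots,p_n)$, a set $X\subseteq\{p_1,\dots,p_n\}$ is a soft stable model of $\mathsf F$ if and only if $X$ satisfies the second-order propositional formula $$\neg\exists{\bf u}\big(({\bf u}<{\bf p})\land\Delta_{{\bf u}}(\{\overline{\mathsf F}\}^{\rm ch})\big).$$
   Context: Let ${\bf p}$ be a list of distinct atoms $p_1,\dots,p_n$ (the propositional signature), and ${\bf u}$ a list of distinct propositional variables $u_1,\dots,u_n$. ${\bf u}\le{\bf p}$ denotes the conjunction of the formulas $u_i\rightarrow p_i$ for $i=1,\dots,n$; ${\bf p}\le{\bf u}$ is defined symmetrically; and ${\bf u}<{\bf p}$ stands for $({\bf u}\le{\bf p})\land\neg({\bf p}\le{\bf u})$. The quantifier $\exists{\bf u}$ ranges over truth values of $u_1,\dots,u_n$. Propositional formulas are built from atoms and $\bot$ using $\land,\lor,\rightarrow$, with $\neg F$ standing for $F\rightarrow\bot$ and $\top$ for $\bot\rightarrow\bot$. An interpretation is identified with the set of atoms true in it; $X\models R$ is classical satisfaction. The reduct $F^X$ is obtained from $F$ by replacing every maximal subformula not (classically) satisfied by $X$ with $\bot$; for a set $\Gamma$ of formulas, $\Gamma^X=\{F^X\mid F\in\Gamma\}$. $X$ is a (standard) stable model of $\Gamma$ if $X$ is a minimal model (with respect to inclusion) of $\Gamma^X$. An ${\rm LP}^{\rm MLN}$ program is a finite set of weighted formulas $w:R$, where $R$ is a propositional formula over ${\bf p}$ and $w$ is a real number or the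 symbol $\alpha$ (infinite weight). $\overline{\mathsf F}$ is the set of formulas obtained from $\mathsf F$ by dropping weights, and $\mathsf F_X$ is the set of those $w:R$ in $\mathsf F$ with $X\models R$. $X$ is a soft stable model of $\mathsf F$ if $X$ is a stable model of $\overline{\mathsf F_X}$. $\{F\}^{\rm ch}$ denotes $F\lor\neg F$, and $\{\Gamma\}^{\rm ch}=\{\{F\}^{\rm ch}\mid F\in\Gamma\}$ for a set $\Gamma$ of formulas. For a formula $F$ over ${\bf p}$, $\Delta_{{\bf u}}(F)$ is defined recursively: $\Delta_{{\bf u}}(p_i)=u_i$; $\Delta_{{\bf u}}(\bot)=\bot$; $\Delta_{{\bf u}}(\neg F)=\neg F$; $\Delta_{{\bf u}}(F\land G)=\Delta_{{\bf u}}(F)\land\Delta_{{\bf u}}(G)$; $\Delta_{{\bf u}}(F\lor G)=\Delta_{{\bf u}}(F)\lor\Delta_{{\bf u}}(G)$; $\Delta_{{\bf u}}(F\rightarrow G)=(\Delta_{{\bf u}}(F)\rightarrow\Delta_{{\bf u}}(G))\land(F\rightarrow G)$. Applied to a finite set of formulas, $\Delta_{{\bf u}}$ is applied to the conjunction of its elements (the empty conjunction being $\top$). -}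

module Defs where

open import Data.Bool using (if_then_else_)
open import Data.Empty using (⊥)
open import Data.Fin using (Fin; _↑ˡ_; _↑ʳ_)
open import Data.Fin.Subset using (Subset; _∈_; _⊂_)
open import Data.Fin.Subset.Properties using (_∈?_)
open import Data.Integer using (+_)
open import Data.List using (List; foldr; map; filter; tabulate)
open import Data.List.Relation.Unary.All using (All)
open import Data.Nat using (ℕ; suc; _+_)
open import Data.Product using (_×_; _,_; proj₂; ∃)
open import Data.Rational as ℚ using (ℚ)
open import Data.Sum using (_⊎_)
open import Data.Vec using (_++_)
open import Relation.Nullary using (¬_; Dec; no; does)
open import Relation.Nullary.Decidable using (_×-dec_; _⊎-dec_; _→-dec_)

private variable
  n : ℕ

infixr 7 _∧_
infixr 6 _∨_
infixr 5 _⇒_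
infix  8 ~_
infix  4 _⊨_ _⊨?_ _⊨²_
infix  9 _^_

-- `Formula n` is the set of propositional formulas over a signature of n
-- distinct atoms, the i-th of which is `atom i`.
data Formula (n : ℕ) : Set where
  atom        : Fin n → Formula n
  bot         : Formula n
  _∧_ _∨_ _⇒_ : Formula n → Formula n → Formula n

~_ : Formula n → Formula n
~ F = F ⇒ bot

top : Formula n
top = bot ⇒ bot

⋀ : List (Formula n) → Formula n
⋀ = foldr _∧_ top

-- An interpretation is the set of atoms true in it.  Satisfaction is decidable
-- (`_⊨?_`), so the constructive reading of the connectives below agrees with
-- the classical truth tables.
_⊨_ : Subset n → Formula n → Set
X ⊨ atom i  = i ∈ X
X ⊨ bot     = ⊥
X ⊨ (F ∧ G) = X ⊨ F × X ⊨ G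
X ⊨ (F ∨ G) = X ⊨ F ⊎ X ⊨ G
X ⊨ (F ⇒ G) = X ⊨ F → X ⊨ G

_⊨?_ : (X : Subset n) (F : Formula n) → Dec (X ⊨ F)
X ⊨? atom i  = i ∈? X
X ⊨? bot     = no λ ()
X ⊨? (F ∧ G) = (X ⊨? F) ×-dec (X ⊨? G)
X ⊨? (F ∨ G) = (X ⊨? F) ⊎-dec (X ⊨? G)
X ⊨? (F ⇒ G) = (X ⊨? F) →-dec (X ⊨? G)

-- The reduct.  The recursion runs from the root and stops at the first
-- subformula not satisfied by X, so that exactly the maximal ones become bot.
_^_ : Formula n → Subset n → Formula n
atom i  ^ X = if does (X ⊨? atom i)  then atom i         else bot
bot     ^ X = bot
(F ∧ G) ^ X = if does (X ⊨? (F ∧ G)) then F ^ X ∧ G ^ X else bot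
(F ∨ G) ^ X = if does (X ⊨? (F ∨ G)) then F ^ X ∨ G ^ X else bot
(F ⇒ G) ^ X = if does (X ⊨? (F ⇒ G)) then F ^ X ⇒ G ^ X else bot

-- Here and below finite sets of formulas are represented by lists; no notion
-- defined on them depends, up to logical equivalence, on order or repetitions.
Model : List (Formula n) → Subset n → Set
Model Γ X = All (X ⊨_) Γ

MinimalModel : List (Formula n) → Subset n → Set
MinimalModel Γ X = Model Γ X × (∀ Y → Y ⊂ X → ¬ Model Γ Y)

StableModel : List (Formula n) → Subset n → Set
StableModel Γ X = MinimalModel (map (_^ X) Γ) X

-- Real numbers as regular Cauchy sequences of rationals (Bishop).
record ℝ : Set where
  field
    approx  : ℕ → ℚ
    regular : ∀ i j → ℚ.∣ approx i ℚ.- approx j ∣ ℚ.≤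
                      (+ 1 ℚ./ suc i) ℚ.+ (+ 1 ℚ./ suc j)

data Weight : Set where
  real : ℝ → Weight
  α    : Weight

Program : ℕ → Set
Program n = List (Weight × Formula n)

dropWeights : Program n → List (Formula n)
dropWeights = map proj₂

satisfiedBy : Subset n → Program n → Program n
satisfiedBy X = filter λ (_ , R) → X ⊨? R

SoftStableModel : Program n → Subset n → Set
SoftStableModel 𝔽 X = StableModel (dropWeights (satisfiedBy X 𝔽)) X

choice : Formula n → Formula n
choice F = F ∨ ~ F

-- Formulas over p₁,…,pₙ,u₁,…,uₙ are elements of `Formula (n + n)`: the first n
-- atoms are the pᵢ and the last n are the uᵢ.
p u : Fin n → Formula (n + n)
p {n} i = atom (i ↑ˡ n)
u {n} i = atom (n ↑ʳ i)

u≤p p≤u u<p : Formula (n + n)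
u≤p {n} = ⋀ (tabulate λ (i : Fin n) → u i ⇒ p i)
p≤u {n} = ⋀ (tabulate λ (i : Fin n) → p i ⇒ u i)
u<p {n} = u≤p {n} ∧ ~ p≤u {n}

-- A formula over p₁,…,pₙ viewed as a formula over p₁,…,pₙ,u₁,…,uₙ.
embed : Formula n → Formula (n + n)
embed (atom i) = p i
embed bot      = bot
embed (F ∧ G)  = embed F ∧ embed G
embed (F ∨ G)  = embed F ∨ embed G
embed (F ⇒ G)  = embed F ⇒ embed G

-- Since ~ F is F ⇒ bot, the clause for negation takes precedence over the
-- clause for implication.
Δ : Formula n → Formula (n + n)
Δ (atom i)  = u i
Δ bot       = bot
Δ (F ∧ G)   = Δ F ∧ Δ G
Δ (F ∨ G)   = Δ F ∨ Δ G
Δ (F ⇒ bot) = ~ embed F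
Δ (F ⇒ G)   = (Δ F ⇒ Δ G) ∧ (embed F ⇒ embed G)

-- Second-order propositional formulas with n free atoms.  `∃² m Φ` binds the
-- last m of the n + m atoms of Φ.
data SOFormula (n : ℕ) : Set where
  prop : Formula n → SOFormula n
  _⇒²_ : SOFormula n → SOFormula n → SOFormula n
  ∃²   : (m : ℕ) → SOFormula (n + m) → SOFormula n

¬² : SOFormula n → SOFormula n
¬² Φ = Φ ⇒² prop bot

_⊨²_ : Subset n → SOFormula n → Set
X ⊨² prop F   = X ⊨ F
X ⊨² (Φ ⇒² Ψ) = X ⊨² Φ → X ⊨² Ψ
X ⊨² ∃² m Φ   = ∃ λ (U : Subset m) → (X ++ U) ⊨² Φ

∃u : Formula (n + n) → SOFormula n
∃u {n} F = ∃² n (prop F)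

{-# OPTIONS --safe #-}
module Submission where

-- Writing a pair (U , X) with U ⊆ X as the interpretation X ++ U of p and u,
-- Δ F holds at X ++ U exactly when U satisfies the reduct F ^ X.  For a choice
-- formula F ∨ ~ F this says that U satisfies F ^ X whenever X satisfies F, so Δ
-- of all the choice formulas says that U is a model of the reduct of the rules
-- satisfied by X.  The second-order formula therefore excludes the proper
-- subsets of X that are models of this reduct; X itself is always one.

open import Data.Bool using (if_then_else_)
open import Data.Empty using (⊥-elim)
open import Data.Fin using (_↑ˡ_; _↑ʳ_)
open import Data.Fin.Subset using (Subset; _∈_; _⊆_; _⊂_)
open import Data.Fin.Subset.Properties using (_∈?_; _⊂?_)
open import Data.List using ([]; _∷_; map)
open import Data.List.Relation.Unary.All as All using ([]; _∷_)
open import Data.List.Relation.Unary.All.Properties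
  using (all-filter; map⁺; tabulate⁺; tabulate⁻)
open import Data.Nat using (ℕ; _+_)
open import Data.Product using (_×_; _,_; proj₁; proj₂; swap)
open import Data.Product.Function.NonDependent.Propositional using (_×-⇔_)
open import Data.Sum as Sum using (inj₁; inj₂; [_,_]′)
open import Data.Sum.Function.Propositional using (_⊎-⇔_)
open import Data.Vec using (_++_)
open import Data.Vec.Properties using (lookup-++ˡ; lookup-++ʳ; []=⇒lookup; lookup⇒[]=)
open import Function using (_∘_; id)
open import Function.Bundles using (_⇔_; mk⇔; Equivalence)
open import Function.Properties.Equivalence using (⇔-isEquivalence)
open import Function.Related.TypeIsomorphisms using (→-cong-⇔)
open import Level using (0ℓ)
open import Relation.Binary.PropositionalEquality using (sym; trans)
open import Relation.Binary.Structures using (IsEquivalence)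
open import Relation.Nullary using (¬_; Dec; yes; no; does)
open import Relation.Nullary.Decidable using (decidable-stable)
open import Defs

open Equivalence using (to; from)
open IsEquivalence (⇔-isEquivalence {ℓ = 0ℓ})
  using () renaming (refl to ⇔-refl; sym to ⇔-sym; trans to ⇔-trans)

private variable
  n : ℕ

∈-++ˡ : ∀ (X U : Subset n) i → i ↑ˡ n ∈ X ++ U ⇔ i ∈ X
∈-++ˡ X U i = mk⇔
  (λ i∈ → lookup⇒[]= i X (trans (sym (lookup-++ˡ X U i)) ([]=⇒lookup i∈)))
  (λ i∈ → lookup⇒[]= _ _ (trans (lookup-++ˡ X U i) ([]=⇒lookup i∈)))

∈-++ʳ : ∀ (X U : Subset n) i → n ↑ʳ i ∈ X ++ U ⇔ i ∈ U
∈-++ʳ X U i = mk⇔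
  (λ i∈ → lookup⇒[]= i U (trans (sym (lookup-++ʳ X U i)) ([]=⇒lookup i∈)))
  (λ i∈ → lookup⇒[]= _ _ (trans (lookup-++ʳ X U i) ([]=⇒lookup i∈)))

⊨embed : ∀ (X U : Subset n) F → X ++ U ⊨ embed F ⇔ X ⊨ F
⊨embed X U (atom i) = ∈-++ˡ X U i
⊨embed X U bot      = ⇔-refl
⊨embed X U (F ∧ G)  = ⊨embed X U F ×-⇔ ⊨embed X U G
⊨embed X U (F ∨ G)  = ⊨embed X U F ⊎-⇔ ⊨embed X U G
⊨embed X U (F ⇒ G)  = →-cong-⇔ (⊨embed X U F) (⊨embed X U G)

-- Every clause of `_^_` except the one for `bot` has this guarded shape, so the case split on the
-- guard is made once for all connectives.
⊨if : ∀ {P : Set} (P? : Dec P) (U : Subset n) F →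
      U ⊨ (if does P? then F else bot) ⇔ (P × U ⊨ F)
⊨if (yes p) U F = mk⇔ (p ,_) proj₂
⊨if (no ¬p) U F = mk⇔ (λ ()) (⊥-elim ∘ ¬p ∘ proj₁)

-- A failed guard at the root leaves `bot`, which no `U` satisfies.
⊨reduct⇒⊨ : ∀ (X U : Subset n) F → U ⊨ F ^ X → X ⊨ F
⊨reduct⇒⊨ X U (atom i) = proj₁ ∘ to (⊨if (X ⊨? atom i) U _)
⊨reduct⇒⊨ X U (F ∧ G)  = proj₁ ∘ to (⊨if (X ⊨? (F ∧ G)) U _)
⊨reduct⇒⊨ X U (F ∨ G)  = proj₁ ∘ to (⊨if (X ⊨? (F ∨ G)) U _)
⊨reduct⇒⊨ X U (F ⇒ G)  = proj₁ ∘ to (⊨if (X ⊨? (F ⇒ G)) U _)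

⊨⇒⊨reduct : ∀ (X : Subset n) F → X ⊨ F → X ⊨ F ^ X
⊨⇒⊨reduct X (atom i) x = from (⊨if (X ⊨? atom i) X _) (x , x)
⊨⇒⊨reduct X (F ∧ G)  x@(f , g) =
  from (⊨if (X ⊨? (F ∧ G)) X _) (x , ⊨⇒⊨reduct X F f , ⊨⇒⊨reduct X G g)
⊨⇒⊨reduct X (F ∨ G)  x@(inj₁ f) =
  from (⊨if (X ⊨? (F ∨ G)) X _) (x , inj₁ (⊨⇒⊨reduct X F f))
⊨⇒⊨reduct X (F ∨ G)  x@(inj₂ g) =
  from (⊨if (X ⊨? (F ∨ G)) X _) (x , inj₂ (⊨⇒⊨reduct X G g))
-- For the antecedent the induction hypothesis points the wrong way; `⊨reduct⇒⊨` supplies the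
-- converse.
⊨⇒⊨reduct X (F ⇒ G)  x =
  from (⊨if (X ⊨? (F ⇒ G)) X _) (x , ⊨⇒⊨reduct X G ∘ x ∘ ⊨reduct⇒⊨ X X F)

-- The hypothesis is what makes the special clause of Δ for negation agree with
-- the general clause for implication.
⊨Δ-⇒ : ∀ (I : Subset (n + n)) (F G : Formula n) → (I ⊨ Δ F → I ⊨ embed F) →
       I ⊨ Δ (F ⇒ G) ⇔ I ⊨ (Δ F ⇒ Δ G) ∧ (embed F ⇒ embed G)
⊨Δ-⇒ I F bot      h = mk⇔ (λ ¬f → ¬f ∘ h , ¬f) proj₂
⊨Δ-⇒ I F (atom _) h = ⇔-refl
⊨Δ-⇒ I F (_ ∧ _)  h = ⇔-refl
⊨Δ-⇒ I F (_ ∨ _)  h = ⇔-refl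
⊨Δ-⇒ I F (_ ⇒ _)  h = ⇔-refl

-- Induction on `F`. The guards of the reduct come from `U ⊆ X` at atoms, from `⊨reduct⇒⊨` on the
-- components at conjunctions and disjunctions, and from the conjunct `embed F ⇒ embed G` at
-- implications.
⊨Δ : ∀ {X U : Subset n} → U ⊆ X → ∀ F → X ++ U ⊨ Δ F ⇔ U ⊨ F ^ X
⊨Δ {X = X} {U} U⊆X (atom i) =
  ⇔-trans (∈-++ʳ X U i)
    (⇔-trans (mk⇔ (λ i∈U → U⊆X i∈U , i∈U) proj₂) (⇔-sym (⊨if (X ⊨? atom i) U _)))
⊨Δ U⊆X bot = ⇔-refl
⊨Δ {X = X} {U} U⊆X (F ∧ G) =
  ⇔-trans (⊨Δ U⊆X F ×-⇔ ⊨Δ U⊆X G)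
    (⇔-trans (mk⇔ (λ (f , g) → (⊨reduct⇒⊨ X U F f , ⊨reduct⇒⊨ X U G g) , f , g) proj₂)
      (⇔-sym (⊨if (X ⊨? (F ∧ G)) U _)))
⊨Δ {X = X} {U} U⊆X (F ∨ G) =
  ⇔-trans (⊨Δ U⊆X F ⊎-⇔ ⊨Δ U⊆X G)
    (⇔-trans (mk⇔ (λ d → Sum.map (⊨reduct⇒⊨ X U F) (⊨reduct⇒⊨ X U G) d , d) proj₂)
      (⇔-sym (⊨if (X ⊨? (F ∨ G)) U _)))
⊨Δ {X = X} {U} U⊆X (F ⇒ G) =
  ⇔-trans (⊨Δ-⇒ (X ++ U) F G (from (⊨embed X U F) ∘ ⊨reduct⇒⊨ X U F ∘ to (⊨Δ U⊆X F)))
    (⇔-trans (→-cong-⇔ (⊨Δ U⊆X F) (⊨Δ U⊆X G) ×-⇔ ⊨embed X U (F ⇒ G))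
      (⇔-trans (mk⇔ swap swap) (⇔-sym (⊨if (X ⊨? (F ⇒ G)) U _))))

⊨Δ-choices : ∀ {X U : Subset n} → U ⊆ X → (𝔽 : Program n) →
             X ++ U ⊨ Δ (⋀ (map choice (dropWeights 𝔽))) ⇔
             Model (map (_^ X) (dropWeights (satisfiedBy X 𝔽))) U
⊨Δ-choices U⊆X [] = mk⇔ (λ _ → []) (λ _ ())
-- This decision also determines whether the filter in `satisfiedBy` keeps `R`. If it does, the
-- disjunct `~ embed R` is false and `Δ R` must hold; if not, that disjunct is true and `R` does not
-- constrain `U`.
⊨Δ-choices {X = X} {U} U⊆X ((_ , R) ∷ 𝔽) with X ⊨? R
... | yes r = mk⇔
  (λ (c , cs) → [ to (⊨Δ U⊆X R) , (λ ¬r → ⊥-elim (¬r (from (⊨embed X U R) r))) ]′ c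
              ∷ to (⊨Δ-choices U⊆X 𝔽) cs)
  (λ { (m ∷ ms) → inj₁ (from (⊨Δ U⊆X R) m) , from (⊨Δ-choices U⊆X 𝔽) ms })
... | no ¬r = mk⇔
  (to (⊨Δ-choices U⊆X 𝔽) ∘ proj₂)
  (λ ms → inj₂ (¬r ∘ to (⊨embed X U R)) , from (⊨Δ-choices U⊆X 𝔽) ms)

⊨⋀ : ∀ (I : Subset n) Γ → I ⊨ ⋀ Γ ⇔ Model Γ I
⊨⋀ I []      = mk⇔ (λ _ → []) (λ _ → id)
⊨⋀ I (F ∷ Γ) = mk⇔ (λ (f , γ) → f ∷ to (⊨⋀ I Γ) γ) (λ { (f ∷ γ) → f , from (⊨⋀ I Γ) γ })

⊨u≤p : ∀ (X U : Subset n) → X ++ U ⊨ u≤p {n} ⇔ U ⊆ X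
⊨u≤p X U = mk⇔
  (λ h {i} → to (∈-++ˡ X U i) ∘ tabulate⁻ (to (⊨⋀ (X ++ U) _) h) i ∘ from (∈-++ʳ X U i))
  (λ U⊆X → from (⊨⋀ (X ++ U) _)
    (tabulate⁺ (λ i → from (∈-++ˡ X U i) ∘ U⊆X ∘ to (∈-++ʳ X U i))))

⊨p≤u : ∀ (X U : Subset n) → X ++ U ⊨ p≤u {n} ⇔ X ⊆ U
⊨p≤u X U = mk⇔
  (λ h {i} → to (∈-++ʳ X U i) ∘ tabulate⁻ (to (⊨⋀ (X ++ U) _) h) i ∘ from (∈-++ˡ X U i))
  (λ X⊆U → from (⊨⋀ (X ++ U) _)
    (tabulate⁺ (λ i → from (∈-++ʳ X U i) ∘ X⊆U ∘ to (∈-++ˡ X U i))))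

-- `_⊂_` demands an explicit element of `X` outside `U`. Decidability of `_⊂_` and of membership
-- allows arguing by contradiction.
⊆∧⊉⇒⊂ : ∀ {X U : Subset n} → U ⊆ X → ¬ X ⊆ U → U ⊂ X
⊆∧⊉⇒⊂ {X = X} {U} U⊆X X⊈U = decidable-stable (U ⊂? X) λ U⊄X →
  X⊈U λ {i} i∈X → decidable-stable (i ∈? U) λ i∉U → U⊄X (U⊆X , i , i∈X , i∉U)

⊨u<p : ∀ (X U : Subset n) → X ++ U ⊨ u<p {n} ⇔ U ⊂ X
⊨u<p X U = mk⇔
  (λ (u≤ , p≰) → ⊆∧⊉⇒⊂ (to (⊨u≤p X U) u≤) (p≰ ∘ from (⊨p≤u X U)))
  (λ (U⊆X , _ , i∈X , i∉U) →
    from (⊨u≤p X U) U⊆X , λ p≤ → i∉U (to (⊨p≤u X U) p≤ i∈X))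

-- The model half of `MinimalModel` is thus automatic, and only minimality remains to be compared
-- with the formula.
satisfied-reduct-model : ∀ (𝔽 : Program n) X →
  Model (map (_^ X) (dropWeights (satisfiedBy X 𝔽))) X
satisfied-reduct-model 𝔽 X =
  map⁺ (map⁺ (All.map (λ {(_ , R)} → ⊨⇒⊨reduct X R) (all-filter (λ (_ , R) → X ⊨? R) 𝔽)))

proposition7 : (n : ℕ) (𝔽 : Program n) (X : Subset n) →
    SoftStableModel 𝔽 X ⇔ (X ⊨² ¬² (∃u (u<p {n} ∧ Δ (⋀ (map choice (dropWeights 𝔽))))))
proposition7 n 𝔽 X = mk⇔
  (λ (_ , minimal) (U , u<p , δ) →
    let U⊂X = to (⊨u<p X U) u<p in
    minimal U U⊂X (to (⊨Δ-choices (proj₁ U⊂X) 𝔽) δ))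
  (λ ¬∃ → satisfied-reduct-model 𝔽 X , λ U U⊂X m →
    ¬∃ (U , from (⊨u<p X U) U⊂X , from (⊨Δ-choices (proj₁ U⊂X) 𝔽) m))
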